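{- For all integers $n \ge 3$ and $d \ge 3$, the spanning tree congestion of the $d$-dimensional Hamming graph $K_n^d$ satisfies \[ \mathrm{stc}(K_{n}^{d}) \ge \frac{(n^{d}-1)\log_{n} d}{d}. \]
   Context: The $d$-dimensional Hamming graph $K_n^d$ is the graph with vertex set $\{0,\dots,n-1\}^d$ in which two vertices are adjacent if and only if their corresponding vectors differ in exactly one coordinate. For a graph $G$ and $S \subseteq V(G)$, $\partial_G(S)$ denotes the set of edges of $G$ with exactly one endpoint in $S$. For a spanning tree $T$ of a connected graph $G$ and an edge $e \in E(T)$, the congestion of $e$ is $|\partial_G(L_e)|$, where $L_e$ is the vertex set of one of the two components of $T - e$; the congestion of $T$ in $G$ is the maximum congestion over all edges of $T$; and the spanning tree congestion $\mathrm{stc}(G)$ is the minimum congestion of $T$ in $G$ over all spanning trees $T$ of $G$. Here $\log_n$ denotes the logarithm to base $n$. -}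

module Defs where

open import Data.Nat using (ℕ; zero; suc; _+_; _≤_; _≟_)
open import Data.Fin using (Fin)
import Data.Fin as F
open import Data.Vec using (Vec; []; _∷_)
open import Data.List using (List; [_]; map; concatMap; allFin)
open import Data.Nat.ListAction using (sum)
open import Data.Bool using (Bool; true; false; if_then_else_; _∧_; not)
open import Data.Product using (Σ; _×_; _,_)
open import Data.Sum using (_⊎_)
open import Relation.Nullary using (¬_)
open import Relation.Nullary.Decidable using (⌊_⌋)
open import Relation.Binary.PropositionalEquality using (_≡_)
open import Function.Bundles using (_⇔_)

-- A finite simple graph: vertex type, a complete list of its vertices
-- (each listed exactly once) and a decidable (Bool-valued) adjacency.
record Graph : Set₁ where
  field
    V     : Set
    verts : List V
    adj   : V → V → Bool

data Reach {V : Set} (E : V → V → Set) : V → V → Set where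
  here : ∀ {x} → Reach E x x
  step : ∀ {x y z} → E x y → Reach E y z → Reach E x z

Minus : {V : Set} → (V → V → Set) → V → V → (V → V → Set)
Minus E u v x y = E x y × ¬ ((x ≡ u × y ≡ v) ⊎ (x ≡ v × y ≡ u))

module _ (G : Graph) where
  open Graph G

  -- |∂_G(S)|: number of edges with exactly one endpoint in S
  -- (each such edge counted once, oriented from S to its complement).
  boundary : (V → Bool) → ℕ
  boundary S = sum (map (λ x → sum (map (λ y →
                 if S x ∧ not (S y) ∧ adj x y then 1 else 0) verts)) verts)

  -- T (given by its symmetric edge relation) is a spanning tree of G:
  -- a subgraph of G on all vertices that is connected and in which
  -- every edge is a bridge (connected + acyclic).
  record SpanningTree (T : V → V → Set) : Set where
    field
      sub     : ∀ x y → T x y → adj x y ≡ true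
      sym     : ∀ x y → T x y → T y x
      conn    : ∀ x y → Reach T x y
      acyclic : ∀ x y → T x y → ¬ Reach (Minus T x y) x y

  EdgeCongestion : (V → V → Set) → V → V → ℕ → Set
  EdgeCongestion T u v c =
    Σ (V → Bool) λ L → (∀ w → (L w ≡ true) ⇔ Reach (Minus T u v) u w)
                       × c ≡ boundary L

  TreeCongestion : (V → V → Set) → ℕ → Set
  TreeCongestion T c =
    (Σ V λ u → Σ V λ v → T u v × EdgeCongestion T u v c)
    × (∀ u v c' → T u v → EdgeCongestion T u v c' → c' ≤ c)

  IsSTC : ℕ → Set₁
  IsSTC k =
    (Σ (V → V → Set) λ T → SpanningTree T × TreeCongestion T k)
    × (∀ T c → SpanningTree T → TreeCongestion T c → k ≤ c)

allVecs : (n d : ℕ) → List (Vec (Fin n) d)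
allVecs n zero = [ [] ]
allVecs n (suc d) = concatMap (λ i → map (i ∷_) (allVecs n d)) (allFin n)

hdist : ∀ {n d} → Vec (Fin n) d → Vec (Fin n) d → ℕ
hdist [] [] = 0
hdist (x ∷ xs) (y ∷ ys) = (if ⌊ x F.≟ y ⌋ then 0 else 1) + hdist xs ys

Hamming : ℕ → ℕ → Graph
Hamming n d = record
  { V = Vec (Fin n) d
  ; verts = allVecs n d
  ; adj = λ u v → ⌊ hdist u v ≟ 1 ⌋
  }

{-# OPTIONS --safe #-}

-- Removing an edge of a spanning tree cuts off a vertex set. In a tree on N vertices of maximum degree
-- at most Δ, every vertex has a branch with at least (N − 1) / Δ vertices, and descending along such
-- branches reaches an edge one of whose sides has size s with (N − 1) / Δ ≤ s ≤ N / 2. For K_n^d we have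
-- N = n^d and Δ = d (n − 1), and the edge-isoperimetric inequality
-- |∂S| ≥ (n − 1) s log_n (N / s) bounds the congestion of that edge from below.
--
-- The isoperimetric inequality is proved by induction on d. A line meeting S in m points contributes
-- m (n − m) boundary edges, at least (n − 1) m (1 − log_n m), so what remains is that the row sums r_a
-- (sizes of the layers of S) and the column sums m_x (sizes of its lines) of a 0/1 matrix with s ones
-- satisfy ∏ r_a ^ r_a ∏ m_x ^ m_x ≤ s ^ s. Logarithms are avoided by exponentiating every inequality.
module Submission where

open import Defs
open import Algebra.Structures using (IsCommutativeMonoid)
open import Data.Bool using (Bool; true; false; if_then_else_; _∧_; not)
open import Data.Fin using (Fin; zero; suc)
import Data.Fin as Fin
open import Data.List using (List; []; _∷_; _++_; map; concatMap; foldr; length; allFin; tabulate)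
open import Data.List.Membership.Propositional using (_∈_)
open import Data.List.Properties using (length-tabulate; map-tabulate)
open import Data.List.Relation.Unary.All as All using (All; []; _∷_)
open import Data.List.Relation.Unary.Any using (here; there)
open import Data.Nat
open import Data.Nat.DivMod using (_/_; _%_; m/n*n≤m; /-monoˡ-≤; m*n/n≡m; m≡m%n+[m/n]*n; m%n<n)
open import Data.Nat.Properties
open import Data.Nat.Tactic.RingSolver using (solve-∀)
open import Data.Product using (Σ; _×_; _,_; proj₁)
open import Data.Sum using (_⊎_; inj₁; inj₂)
open import Data.Vec using (Vec; []; _∷_; replicate)
import Data.Vec.Properties as Vec
open import Function using (_∘_; id; mk⇔; _⇔_)
open import Relation.Binary.Definitions using (DecidableEquality)
open import Relation.Binary.PropositionalEquality
open import Relation.Nullary using (Dec; yes; no; ¬_; contradiction)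
open import Relation.Nullary.Decidable using (⌊_⌋; map′; ¬¬-excluded-middle; decidable-stable)

-- Finite sums and products over lists.

module BigOp {_∙_ : ℕ → ℕ → ℕ} {ε : ℕ} (M : IsCommutativeMonoid _≡_ _∙_ ε) where
  open IsCommutativeMonoid M using () renaming (assoc to ∙-assoc; comm to ∙-comm; identityˡ to ∙-identityˡ)

  -- Taken as a fold of a `map` so that `∑` unfolds to the same term as the `sum` in `boundary`.
  fold : {A : Set} → List A → (A → ℕ) → ℕ
  fold xs f = foldr _∙_ ε (map f xs)

  fold-cong : {A : Set} (xs : List A) {f g : A → ℕ} → (∀ x → f x ≡ g x) → fold xs f ≡ fold xs g
  fold-cong []       h = refl
  fold-cong (x ∷ xs) h = cong₂ _∙_ (h x) (fold-cong xs h)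

  fold-mono : {A : Set} → (∀ {a b c d} → a ≤ b → c ≤ d → a ∙ c ≤ b ∙ d) →
              (xs : List A) {f g : A → ℕ} → (∀ x → f x ≤ g x) → fold xs f ≤ fold xs g
  fold-mono mono []       h = ≤-refl
  fold-mono mono (x ∷ xs) h = mono (h x) (fold-mono mono xs h)

  fold-ε : {A : Set} (xs : List A) → fold xs (λ _ → ε) ≡ ε
  fold-ε []       = refl
  fold-ε (x ∷ xs) = trans (∙-identityˡ _) (fold-ε xs)

  interchange : ∀ a b c d → (a ∙ b) ∙ (c ∙ d) ≡ (a ∙ c) ∙ (b ∙ d)
  interchange a b c d = begin
    (a ∙ b) ∙ (c ∙ d) ≡⟨ ∙-assoc a b _ ⟩
    a ∙ (b ∙ (c ∙ d)) ≡⟨ cong (a ∙_) (trans (sym (∙-assoc b c d)) (cong (_∙ d) (∙-comm b c))) ⟩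
    a ∙ ((c ∙ b) ∙ d) ≡⟨ cong (a ∙_) (∙-assoc c b d) ⟩
    a ∙ (c ∙ (b ∙ d)) ≡⟨ ∙-assoc a c _ ⟨
    (a ∙ c) ∙ (b ∙ d) ∎
    where open ≡-Reasoning

  fold-∙ : {A : Set} (xs : List A) (f g : A → ℕ) →
           fold xs (λ x → f x ∙ g x) ≡ fold xs f ∙ fold xs g
  fold-∙ []       f g = sym (∙-identityˡ ε)
  fold-∙ (x ∷ xs) f g =
    trans (cong ((f x ∙ g x) ∙_) (fold-∙ xs f g)) (interchange (f x) (g x) _ _)

  fold-swap : {A B : Set} (xs : List A) (ys : List B) (f : A → B → ℕ) →
              fold xs (λ x → fold ys (f x)) ≡ fold ys (λ y → fold xs (λ x → f x y))
  fold-swap []       ys f = sym (fold-ε ys)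
  fold-swap (x ∷ xs) ys f =
    trans (cong (fold ys (f x) ∙_) (fold-swap xs ys f)) (sym (fold-∙ ys (f x) _))

  fold-++ : {A : Set} (xs ys : List A) (f : A → ℕ) → fold (xs ++ ys) f ≡ fold xs f ∙ fold ys f
  fold-++ []       ys f = sym (∙-identityˡ _)
  fold-++ (x ∷ xs) ys f = trans (cong (f x ∙_) (fold-++ xs ys f)) (sym (∙-assoc (f x) _ _))

  fold-map : {A B : Set} (g : A → B) (xs : List A) (f : B → ℕ) →
             fold (map g xs) f ≡ fold xs (λ x → f (g x))
  fold-map g []       f = refl
  fold-map g (x ∷ xs) f = cong (f (g x) ∙_) (fold-map g xs f)

  fold-concatMap : {A B : Set} (g : A → List B) (xs : List A) (f : B → ℕ) →
                   fold (concatMap g xs) f ≡ fold xs (λ x → fold (g x) f)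
  fold-concatMap g []       f = refl
  fold-concatMap g (x ∷ xs) f =
    trans (fold-++ (g x) (concatMap g xs) f) (cong (fold (g x) f ∙_) (fold-concatMap g xs f))

  fold-grid : {A B C : Set} (g : A → B → C) (xs : List A) (ys : List B) (f : C → ℕ) →
              fold (concatMap (λ x → map (g x) ys) xs) f ≡ fold xs (λ x → fold ys (λ y → f (g x y)))
  fold-grid g xs ys f =
    trans (fold-concatMap (λ x → map (g x) ys) xs f) (fold-cong xs (λ x → fold-map (g x) ys f))

open BigOp +-0-isCommutativeMonoid using () renaming
  (fold to ∑; fold-cong to ∑-cong; fold-ε to ∑-0; fold-∙ to ∑-+; fold-swap to ∑-swap; fold-grid to ∑-grid)
open BigOp *-1-isCommutativeMonoid using () renaming
  (fold to ∏; fold-cong to ∏-cong; fold-∙ to ∏-*; fold-swap to ∏-swap; fold-grid to ∏-grid)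

∑-mono : {A : Set} (xs : List A) {f g : A → ℕ} → (∀ x → f x ≤ g x) → ∑ xs f ≤ ∑ xs g
∑-mono = BigOp.fold-mono +-0-isCommutativeMonoid +-mono-≤

∏-mono : {A : Set} (xs : List A) {f g : A → ℕ} → (∀ x → f x ≤ g x) → ∏ xs f ≤ ∏ xs g
∏-mono = BigOp.fold-mono *-1-isCommutativeMonoid *-mono-≤

∑-*ˡ : {A : Set} (k : ℕ) (xs : List A) (f : A → ℕ) → ∑ xs (λ x → k * f x) ≡ k * ∑ xs f
∑-*ˡ k []       f = sym (*-zeroʳ k)
∑-*ˡ k (x ∷ xs) f = trans (cong (k * f x +_) (∑-*ˡ k xs f)) (sym (*-distribˡ-+ k (f x) _))

∑-*ʳ : {A : Set} (k : ℕ) (xs : List A) (f : A → ℕ) → ∑ xs (λ x → f x * k) ≡ ∑ xs f * k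
∑-*ʳ k xs f = trans (∑-cong xs (λ x → *-comm (f x) k)) (trans (∑-*ˡ k xs f) (*-comm k _))

∑-const : {A : Set} (k : ℕ) (xs : List A) → ∑ xs (λ _ → k) ≡ length xs * k
∑-const k []       = refl
∑-const k (x ∷ xs) = cong (k +_) (∑-const k xs)

^-∑ : {A : Set} (k : ℕ) (xs : List A) (f : A → ℕ) → k ^ ∑ xs f ≡ ∏ xs (λ x → k ^ f x)
^-∑ k []       f = refl
^-∑ k (x ∷ xs) f = trans (^-distribˡ-+-* k (f x) _) (cong (k ^ f x *_) (^-∑ k xs f))

*-interchange : ∀ a b c d → (a * b) * (c * d) ≡ (a * c) * (b * d)
*-interchange = BigOp.interchange *-1-isCommutativeMonoid

^-distribʳ-* : ∀ k a b → (a * b) ^ k ≡ a ^ k * b ^ k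
^-distribʳ-* zero    a b = refl
^-distribʳ-* (suc k) a b =
  trans (cong (a * b *_) (^-distribʳ-* k a b)) (*-interchange a b (a ^ k) (b ^ k))

∏-^ : {A : Set} (k : ℕ) (xs : List A) (f : A → ℕ) → ∏ xs (λ x → f x ^ k) ≡ ∏ xs f ^ k
∏-^ k []       f = sym (^-zeroˡ k)
∏-^ k (x ∷ xs) f = trans (cong (f x ^ k *_) (∏-^ k xs f)) (sym (^-distribʳ-* k (f x) _))

𝟙 : Bool → ℕ
𝟙 b = if b then 1 else 0

𝟙≤1 : ∀ b → 𝟙 b ≤ 1
𝟙≤1 false = z≤n
𝟙≤1 true  = ≤-refl

𝟙-complement : {A : Set} (xs : List A) (b : A → Bool) →
               ∑ xs (λ x → 𝟙 (b x)) + ∑ xs (λ x → 𝟙 (not (b x))) ≡ length xs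
𝟙-complement xs b = trans (sym (∑-+ xs _ _))
  (trans (∑-cong xs (λ x → pointwise (b x))) (trans (∑-const 1 xs) (*-identityʳ _)))
  where
  pointwise : ∀ c → 𝟙 c + 𝟙 (not c) ≡ 1
  pointwise false = refl
  pointwise true  = refl

-- AM-GM for natural numbers and the margins of a 0/1 matrix.

n^n>0 : ∀ n → n ^ n > 0
n^n>0 zero    = s≤s z≤n
n^n>0 (suc n) = m^n>0 (suc n) (suc n)

-- The two sides differ by (b - a) (y - x).
mixed≤pure : ∀ {a b x y} → a ≤ b → x ≤ y → a * y + b * x ≤ a * x + b * y
mixed≤pure {a} {x = x} a≤b x≤y with m≤n⇒∃[o]m+o≡n a≤b | m≤n⇒∃[o]m+o≡n x≤y
... | e , refl | f , refl = subst (a * (x + f) + (a + e) * x ≤_) (expand a e x f) (m≤m+n _ (e * f))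
  where
  expand : ∀ a e x f → (a * (x + f) + (a + e) * x) + e * f ≡ a * x + (a + e) * (x + f)
  expand = solve-∀

power-rearrangement : ∀ a b k → a * b ^ k + b * a ^ k ≤ a * a ^ k + b * b ^ k
power-rearrangement a b k with ≤-total a b
... | inj₁ a≤b = mixed≤pure a≤b (^-monoˡ-≤ k a≤b)
... | inj₂ b≤a = subst₂ _≤_ (+-comm (b * a ^ k) _) (+-comm (b * b ^ k) _)
                            (mixed≤pure b≤a (^-monoˡ-≤ k b≤a))

-- Convexity: the power with exponent k + 1 lies above its tangent at b, with the negative term
-- moved across. In the induction, multiplying by b leaves mixed products of a and b, which the
-- rearrangement bound turns into pure powers.
bernoulli : ∀ k a b → suc k * (a * b ^ k) ≤ a ^ suc k + k * b ^ suc k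
bernoulli zero    a b = ≤-refl
bernoulli (suc k) a b = begin
  suc (suc k) * (a * (b * b ^ k))                         ≡⟨ split k a b (b ^ k) ⟩
  b * (suc k * (a * b ^ k)) + a * b ^ suc k               ≤⟨ +-monoˡ-≤ _ (*-monoʳ-≤ b (bernoulli k a b)) ⟩
  b * (a ^ suc k + k * b ^ suc k) + a * b ^ suc k         ≡⟨ regroup k a b (a ^ suc k) (b ^ suc k) ⟩
  (a * b ^ suc k + b * a ^ suc k) + k * (b * b ^ suc k)   ≤⟨ +-monoˡ-≤ _ (power-rearrangement a b (suc k)) ⟩
  (a * a ^ suc k + b * b ^ suc k) + k * (b * b ^ suc k)   ≡⟨ +-assoc (a * a ^ suc k) _ _ ⟩
  a ^ suc (suc k) + suc k * b ^ suc (suc k)               ∎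
  where
  open ≤-Reasoning
  split : ∀ k a b p → suc (suc k) * (a * (b * p)) ≡ b * (suc k * (a * p)) + a * (b * p)
  split = solve-∀
  regroup : ∀ k a b p q → b * (p + k * q) + a * q ≡ (a * q + b * p) + k * (b * q)
  regroup = solve-∀

-- AM–GM with weights 1 and k, from Bernoulli with a = k (x + y) and b = (k + 1) y.
two-point-AM-GM : ∀ k x y → suc k ^ suc k * (x * y ^ k) ≤ k ^ k * (x + y) ^ suc k
two-point-AM-GM zero    x y = begin
  1 * (x * 1)         ≡⟨ cong (1 *_) (*-identityʳ x) ⟩
  1 * x               ≤⟨ *-monoʳ-≤ 1 (m≤m+n x y) ⟩
  1 * (x + y)         ≡⟨ cong (1 *_) (*-identityʳ (x + y)) ⟨
  1 * ((x + y) * 1)   ∎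
  where open ≤-Reasoning
two-point-AM-GM k@(suc _) x y =
  -- Besides the summand k B ^ (k + 1), a factor k is cancelled, which is why k = 0 has its own
  -- clause.
  *-cancelˡ-≤ k (+-cancelʳ-≤ (k * B ^ suc k) _ _ (begin
    k * (suc k ^ suc k * (x * y ^ k)) + k * B ^ suc k
      ≡⟨ cong (_+ k * B ^ suc k) (gather k x (suc k ^ k) (y ^ k)) ⟩
    k * (suc k * (x * (suc k ^ k * y ^ k))) + k * B ^ suc k
      ≡⟨ cong (λ p → k * (suc k * (x * p)) + k * B ^ suc k) (^-distribʳ-* k (suc k) y) ⟨
    k * (suc k * (x * B ^ k)) + k * (B * B ^ k)
      ≡⟨ refactor k x y (B ^ k) ⟩
    suc k * (A * B ^ k)
      ≤⟨ bernoulli k A B ⟩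
    A ^ suc k + k * B ^ suc k
      ≡⟨ cong (_+ k * B ^ suc k) (^-distribʳ-* (suc k) k (x + y)) ⟩
    k ^ suc k * (x + y) ^ suc k + k * B ^ suc k
      ≡⟨ cong (_+ k * B ^ suc k) (*-assoc k (k ^ k) _) ⟩
    k * (k ^ k * (x + y) ^ suc k) + k * B ^ suc k ∎))
  where
  open ≤-Reasoning
  A = k * (x + y)
  B = suc k * y
  gather : ∀ k x p q → k * ((suc k * p) * (x * q)) ≡ k * (suc k * (x * (p * q)))
  gather = solve-∀
  refactor : ∀ k x y p → k * (suc k * (x * p)) + k * ((suc k * y) * p) ≡ suc k * ((k * (x + y)) * p)
  refactor = solve-∀

-- The hypothesis is AM-GM for k numbers with product p and sum y; the conclusion adjoins x to them.
AM-GM-step : ∀ k p x y → k ^ k * p ≤ y ^ k → suc k ^ suc k * (x * p) ≤ (x + y) ^ suc k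
AM-GM-step k p x y h = *-cancelˡ-≤ (k ^ k) {{>-nonZero (n^n>0 k)}} (begin
  k ^ k * (suc k ^ suc k * (x * p))   ≡⟨ permute (k ^ k) (suc k ^ suc k) x p ⟩
  suc k ^ suc k * (x * (k ^ k * p))   ≤⟨ *-monoʳ-≤ (suc k ^ suc k) (*-monoʳ-≤ x h) ⟩
  suc k ^ suc k * (x * y ^ k)         ≤⟨ two-point-AM-GM k x y ⟩
  k ^ k * (x + y) ^ suc k             ∎)
  where
  open ≤-Reasoning
  permute : ∀ a b x p → a * (b * (x * p)) ≡ b * (x * (a * p))
  permute = solve-∀

-- The indicators select k entries, and roots and denominators are cleared. Since 0 ^ 0 = 1, the
-- empty selection gives 1 ≤ 1.
AM-GM : {A : Set} (xs : List A) (b : A → Bool) (v : A → ℕ) → let k = ∑ xs (λ x → 𝟙 (b x)) in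
        k ^ k * ∏ xs (λ x → v x ^ 𝟙 (b x)) ≤ ∑ xs (λ x → 𝟙 (b x) * v x) ^ k
AM-GM []       b v = ≤-refl
AM-GM (x ∷ xs) b v = extend (b x)
  where
  k = ∑ xs (λ x → 𝟙 (b x))
  p = ∏ xs (λ x → v x ^ 𝟙 (b x))
  y = ∑ xs (λ x → 𝟙 (b x) * v x)
  extend : ∀ c → (𝟙 c + k) ^ (𝟙 c + k) * (v x ^ 𝟙 c * p) ≤ (𝟙 c * v x + y) ^ (𝟙 c + k)
  extend false = subst (λ q → k ^ k * q ≤ y ^ k) (sym (*-identityˡ p)) (AM-GM xs b v)
  extend true  = subst₂ (λ q r → suc k ^ suc k * (q * p) ≤ (r + y) ^ suc k)
                   (sym (*-identityʳ (v x))) (sym (*-identityˡ (v x)))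
                   (AM-GM-step k p (v x) y (AM-GM xs b v))

𝟙*≤ : ∀ b k → 𝟙 b * k ≤ k
𝟙*≤ false k = z≤n
𝟙*≤ true  k = ≤-reflexive (*-identityˡ k)

-- AM–GM over the cells of a 0/1 matrix, each carrying (its row sum) × (its column sum): there are s
-- cells and these products total at most s², so their geometric mean is at most s.
margins-bound : {A B : Set} (xs : List A) (ys : List B) (m : A → B → Bool) →
  let row    = λ x → ∑ ys (λ y → 𝟙 (m x y))
      column = λ y → ∑ xs (λ x → 𝟙 (m x y))
      s      = ∑ xs row
  in ∏ xs (λ x → row x ^ row x) * ∏ ys (λ y → column y ^ column y) ≤ s ^ s
margins-bound xs ys m = *-cancelˡ-≤ (s ^ s) {{>-nonZero (n^n>0 s)}} (begin
  s ^ s * (∏ xs (λ x → row x ^ row x) * ∏ ys (λ y → column y ^ column y))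
    ≡⟨ cong (s ^ s *_) over-cells ⟩
  s ^ s * ∏ xs (λ x → ∏ ys (λ y → (row x * column y) ^ 𝟙 (m x y)))
    ≡⟨ cong₂ (λ k p → k ^ k * p) count (∏-grid _,_ xs ys _) ⟨
  k ^ k * ∏ cells (λ (x , y) → (row x * column y) ^ 𝟙 (m x y))
    ≤⟨ AM-GM cells _ _ ⟩
  ∑ cells (λ (x , y) → 𝟙 (m x y) * (row x * column y)) ^ k
    ≤⟨ ^-monoˡ-≤ k (∑-mono cells (λ (x , y) → 𝟙*≤ (m x y) _)) ⟩
  ∑ cells (λ (x , y) → row x * column y) ^ k
    ≡⟨ cong₂ _^_ total count ⟩
  (s * s) ^ s
    ≡⟨ ^-distribʳ-* s s s ⟩
  s ^ s * s ^ s ∎)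
  where
  open ≤-Reasoning
  row = λ x → ∑ ys (λ y → 𝟙 (m x y))
  column = λ y → ∑ xs (λ x → 𝟙 (m x y))
  s = ∑ xs row
  cells = concatMap (λ x → map (x ,_) ys) xs
  k = ∑ cells (λ (x , y) → 𝟙 (m x y))
  count : k ≡ s
  count = ∑-grid _,_ xs ys _
  total : ∑ cells (λ (x , y) → row x * column y) ≡ s * s
  total = begin-equality
    ∑ cells (λ (x , y) → row x * column y)      ≡⟨ ∑-grid _,_ xs ys _ ⟩
    ∑ xs (λ x → ∑ ys (λ y → row x * column y))  ≡⟨ ∑-cong xs (λ x → ∑-*ˡ (row x) ys column) ⟩
    ∑ xs (λ x → row x * ∑ ys column)            ≡⟨ ∑-*ʳ (∑ ys column) xs row ⟩
    s * ∑ ys column                             ≡⟨ cong (s *_) (∑-swap xs ys _) ⟨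
    s * s                                       ∎
  -- A row with sum r has r selected cells, so r ^ r contributes one factor r to each of them;
  -- likewise for columns.
  over-cells : ∏ xs (λ x → row x ^ row x) * ∏ ys (λ y → column y ^ column y)
             ≡ ∏ xs (λ x → ∏ ys (λ y → (row x * column y) ^ 𝟙 (m x y)))
  over-cells = begin-equality
    ∏ xs (λ x → row x ^ row x) * ∏ ys (λ y → column y ^ column y)
      ≡⟨ cong₂ _*_ (∏-cong xs (λ x → ^-∑ (row x) ys _))
                   (trans (∏-cong ys (λ y → ^-∑ (column y) xs _)) (∏-swap ys xs _)) ⟩
    ∏ xs (λ x → ∏ ys (λ y → row x ^ 𝟙 (m x y))) * ∏ xs (λ x → ∏ ys (λ y → column y ^ 𝟙 (m x y)))
      ≡⟨ ∏-* xs _ _ ⟨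
    ∏ xs (λ x → ∏ ys (λ y → row x ^ 𝟙 (m x y)) * ∏ ys (λ y → column y ^ 𝟙 (m x y)))
      ≡⟨ ∏-cong xs (λ x → ∏-* ys _ _) ⟨
    ∏ xs (λ x → ∏ ys (λ y → row x ^ 𝟙 (m x y) * column y ^ 𝟙 (m x y)))
      ≡⟨ ∏-cong xs (λ x → ∏-cong ys (λ y → ^-distribʳ-* (𝟙 (m x y)) (row x) (column y))) ⟨
    ∏ xs (λ x → ∏ ys (λ y → (row x * column y) ^ 𝟙 (m x y))) ∎

-- Comparison of powers with base and exponent exchanged.

[1+m]^k≤[1+k]*m^k : ∀ m k → k ≤ m → suc m ^ k ≤ suc k * m ^ k
[1+m]^k≤[1+k]*m^k m zero    _   = ≤-refl
[1+m]^k≤[1+k]*m^k m (suc k) k<m = begin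
  suc m * suc m ^ k               ≤⟨ *-monoʳ-≤ (suc m) ([1+m]^k≤[1+k]*m^k m k (<⇒≤ k<m)) ⟩
  suc m * (suc k * m ^ k)         ≡⟨ expand m k (m ^ k) ⟩
  -- Passing from k to k + 1 costs a factor 1 + 1/m, which is at most (k + 2) / (k + 1) because k +
  -- 1 ≤ m.
  (suc k * m + suc k) * m ^ k     ≤⟨ *-monoˡ-≤ (m ^ k) (+-monoʳ-≤ (suc k * m) k<m) ⟩
  (suc k * m + m) * m ^ k         ≡⟨ regroup m k (m ^ k) ⟩
  suc (suc k) * (m * m ^ k)       ∎
  where
  open ≤-Reasoning
  expand : ∀ m k p → suc m * (suc k * p) ≡ (suc k * m + suc k) * p
  expand = solve-∀
  regroup : ∀ m k p → (suc k * m + m) * p ≡ suc (suc k) * (m * p)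
  regroup = solve-∀

-- log m / (m − 1) is antitone: n ^ (m − 1) ≤ m ^ (n − 1) for m = 1 + k and n = m + c.
power-exchange : ∀ k c → (suc k + c) ^ k ≤ suc k ^ (k + c)
power-exchange k zero    = ≤-reflexive (cong₂ _^_ (+-identityʳ (suc k)) (sym (+-identityʳ k)))
power-exchange k (suc c) = begin
  (suc k + suc c) ^ k       ≡⟨ cong (_^ k) (+-suc (suc k) c) ⟩
  suc (suc k + c) ^ k       ≤⟨ [1+m]^k≤[1+k]*m^k (suc k + c) k (≤-trans (n≤1+n k) (m≤m+n (suc k) c)) ⟩
  suc k * (suc k + c) ^ k   ≤⟨ *-monoʳ-≤ (suc k) (power-exchange k c) ⟩
  suc k ^ suc (k + c)       ≡⟨ cong (suc k ^_) (+-suc k c) ⟨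
  suc k ^ (k + suc c)       ∎
  where open ≤-Reasoning

-- This is m c ≥ n m (1 - log_N m) for a line of N = n + 1 points, m of them in the set. For m > 0,
-- n m = m c + m (m - 1), so it reduces to N ^ (m - 1) ≤ m ^ n, an instance of `power-exchange`.
column-bound : ∀ n m c → m + c ≡ suc n → suc n ^ (n * m) ≤ suc n ^ (m * c) * (m ^ m) ^ n
column-bound n zero    c _ = ≤-reflexive (trans (cong (suc n ^_) (*-zeroʳ n)) (sym (trans (*-identityˡ _) (^-zeroˡ n))))
column-bound n (suc k) c refl = begin
  N ^ ((k + c) * suc k)                       ≡⟨ cong (N ^_) (exponent k c) ⟩
  N ^ (c * suc k + k * suc k)                 ≡⟨ ^-distribˡ-+-* N (c * suc k) _ ⟩
  N ^ (c * suc k) * N ^ (k * suc k)           ≡⟨ cong₂ _*_ (cong (N ^_) (*-comm c (suc k))) (sym (^-*-assoc N k (suc k))) ⟩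
  N ^ (suc k * c) * (N ^ k) ^ suc k           ≤⟨ *-monoʳ-≤ (N ^ (suc k * c)) (^-monoˡ-≤ (suc k) (power-exchange k c)) ⟩
  N ^ (suc k * c) * (suc k ^ (k + c)) ^ suc k ≡⟨ cong (N ^ (suc k * c) *_) (^-swap (suc k) (k + c) (suc k)) ⟩
  N ^ (suc k * c) * (suc k ^ suc k) ^ (k + c) ∎
  where
  open ≤-Reasoning
  N = suc (k + c)
  exponent : ∀ k c → (k + c) * suc k ≡ c * suc k + k * suc k
  exponent = solve-∀
  ^-swap : ∀ a b c → (a ^ b) ^ c ≡ (a ^ c) ^ b
  ^-swap a b c = trans (^-*-assoc a b c) (trans (cong (a ^_) (*-comm b c)) (sym (^-*-assoc a c b)))

-- Supplies the case q = 2 of the next lemma. The excess of 4 n³ over (n + 1)³ is a polynomial in e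
-- with positive coefficients.
n³≤4^n : ∀ e → (3 + e) ^ 3 ≤ 4 ^ (3 + e)
n³≤4^n zero    = m≤m+n 27 37
n³≤4^n (suc e) = begin
  (4 + e) ^ 3                                                     ≤⟨ m≤m+n _ _ ⟩
  (4 + e) ^ 3 + (44 + 60 * e + 24 * (e * e) + 3 * (e * (e * e)))  ≡⟨ expand e ⟩
  4 * (3 + e) ^ 3                                                 ≤⟨ *-monoʳ-≤ 4 (n³≤4^n e) ⟩
  4 ^ (4 + e)                                                     ∎
  where
  open ≤-Reasoning
  expand : ∀ e → (4 + e) * ((4 + e) * ((4 + e) * 1)) + (44 + 60 * e + 24 * (e * e) + 3 * (e * (e * e)))
               ≡ 4 * ((3 + e) * ((3 + e) * ((3 + e) * 1)))
  expand = solve-∀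

-- For q ≥ 3, q + 1 ≤ 2 (q - 1), so squaring d ^ (q - 1) ≤ q ^ (d - 1) suffices. For q = 2 that
-- comparison of exponents fails, and the cubic bound takes over.
d^[1+q]≤q^2d : ∀ q d → 3 ≤ d → 2 ≤ q → q ≤ d → d ^ suc q ≤ q ^ (2 * d)
d^[1+q]≤q^2d 1 d _ (s≤s ()) _
d^[1+q]≤q^2d 2 d 3≤d _ _ with m≤n⇒∃[o]m+o≡n 3≤d
... | e , refl = ≤-trans (n³≤4^n e) (≤-reflexive (^-*-assoc 2 2 (3 + e)))
d^[1+q]≤q^2d q@(suc k@(suc (suc j))) d _ _ q≤d with m≤n⇒∃[o]m+o≡n q≤d
... | c , refl = begin
  d ^ (2 + k)            ≤⟨ ^-monoʳ-≤ d (+-monoʳ-≤ 2 (m≤m+n k j)) ⟩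
  d ^ (2 + (k + j))      ≡⟨ cong (d ^_) (double j) ⟩
  d ^ (k * 2)            ≡⟨ ^-*-assoc d k 2 ⟨
  (d ^ k) ^ 2            ≤⟨ ^-monoˡ-≤ 2 (power-exchange k c) ⟩
  (q ^ (k + c)) ^ 2      ≡⟨ ^-*-assoc q (k + c) 2 ⟩
  q ^ ((k + c) * 2)      ≤⟨ ^-monoʳ-≤ q (≤-trans (*-monoˡ-≤ 2 (n≤1+n (k + c))) (≤-reflexive (*-comm d 2))) ⟩
  q ^ (2 * d)            ∎
  where
  open ≤-Reasoning
  double : ∀ j → 2 + ((2 + j) + j) ≡ (2 + j) * 2
  double = solve-∀

2≤[1+n]^d : ∀ n d → 2 ≤ n → 3 ≤ d → 2 ≤ suc n ^ d
2≤[1+n]^d n d 2≤n 3≤d = begin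
  2         ≤⟨ ≤-trans 2≤n (n≤1+n n) ⟩
  suc n     ≡⟨ ^-identityʳ (suc n) ⟨
  suc n ^ 1 ≤⟨ ^-monoʳ-≤ (suc n) (≤-trans (s≤s z≤n) 3≤d) ⟩
  suc n ^ d ∎
  where open ≤-Reasoning

-- The paper's n is suc n. With q = ⌊(suc n)^d / s⌋ the isoperimetric hypothesis gives
-- q ^ (n s) ≤ (suc n) ^ b, which is enough both when d ≤ q and when q < d.
congestion-arithmetic : ∀ n d s b → let M = suc n ^ d in 2 ≤ n → 3 ≤ d →
  M ≤ suc (d * n * s) → 2 * s ≤ M →
  suc n ^ (d * (n * s)) ≤ suc n ^ b * (s ^ s) ^ n →
  d ^ (M ∸ 1) ≤ suc n ^ (d * b)
congestion-arithmetic n d zero b 2≤n 3≤d big _ _ =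
  contradiction (≤-trans (2≤[1+n]^d n d 2≤n 3≤d) (≤-trans big (≤-reflexive (cong suc (*-zeroʳ (d * n)))))) λ { (s≤s ()) }
congestion-arithmetic n d s@(suc _) b 2≤n 3≤d big 2s≤M iso = begin
  d ^ (M ∸ 1)         ≤⟨ d^[M-1]≤q^[dns] ⟩
  q ^ (d * n * s)     ≡⟨ cong (q ^_) (trans (*-assoc d n s) (*-comm d (n * s))) ⟩
  q ^ (n * s * d)     ≡⟨ ^-*-assoc q (n * s) d ⟨
  (q ^ (n * s)) ^ d   ≤⟨ ^-monoˡ-≤ d q^[ns]≤N^b ⟩
  (N ^ b) ^ d         ≡⟨ trans (^-*-assoc N b d) (cong (N ^_) (*-comm b d)) ⟩
  N ^ (d * b)         ∎
  where
  open ≤-Reasoning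
  N = suc n
  M = N ^ d
  q = M / s
  2≤q : 2 ≤ q
  2≤q = subst (_≤ q) (m*n/n≡m 2 s) (/-monoˡ-≤ s 2s≤M)
  instance
    q≢0 : NonZero q
    q≢0 = >-nonZero (≤-trans (s≤s z≤n) 2≤q)
    d≢0 : NonZero d
    d≢0 = >-nonZero (≤-trans (s≤s z≤n) 3≤d)
  M-1≤[1+q]s : M ∸ 1 ≤ suc q * s
  M-1≤[1+q]s = begin
    M ∸ 1             ≤⟨ m∸n≤m M 1 ⟩
    M                 ≡⟨ m≡m%n+[m/n]*n M s ⟩
    M % s + q * s     ≤⟨ +-monoˡ-≤ (q * s) (<⇒≤ (m%n<n M s)) ⟩
    suc q * s         ∎
  q^[ns]≤N^b : q ^ (n * s) ≤ N ^ b
  q^[ns]≤N^b = *-cancelʳ-≤ _ _ (s ^ (n * s)) {{m^n≢0 s (n * s)}} (begin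
    q ^ (n * s) * s ^ (n * s)   ≡⟨ ^-distribʳ-* (n * s) q s ⟨
    (q * s) ^ (n * s)           ≤⟨ ^-monoˡ-≤ (n * s) (m/n*n≤m M s) ⟩
    M ^ (n * s)                 ≡⟨ ^-*-assoc N d (n * s) ⟩
    N ^ (d * (n * s))           ≤⟨ iso ⟩
    N ^ b * (s ^ s) ^ n         ≡⟨ cong (N ^ b *_) (trans (^-*-assoc s s n) (cong (s ^_) (*-comm s n))) ⟩
    N ^ b * s ^ (n * s)         ∎)
  d^[M-1]≤q^[dns] : d ^ (M ∸ 1) ≤ q ^ (d * n * s)
  d^[M-1]≤q^[dns] with ≤-total d q
  -- The base may grow from d to q, and `big` says M - 1 ≤ d n s.
  ... | inj₁ d≤q = ≤-trans (^-monoˡ-≤ (M ∸ 1) d≤q) (^-monoʳ-≤ q (∸-monoˡ-≤ 1 big))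
  -- The base has to shrink, so the exponent is first bounded by (q + 1) s, from M < (q + 1) s. The
  -- exchange then yields 2 d s, and 2 ≤ n brings this below d n s.
  ... | inj₂ q≤d = begin
    d ^ (M ∸ 1)         ≤⟨ ^-monoʳ-≤ d M-1≤[1+q]s ⟩
    d ^ (suc q * s)     ≡⟨ ^-*-assoc d (suc q) s ⟨
    (d ^ suc q) ^ s     ≤⟨ ^-monoˡ-≤ s (d^[1+q]≤q^2d q d 3≤d 2≤q q≤d) ⟩
    (q ^ (2 * d)) ^ s   ≡⟨ ^-*-assoc q (2 * d) s ⟩
    q ^ (2 * d * s)     ≤⟨ ^-monoʳ-≤ q (*-monoˡ-≤ s (≤-trans (*-monoˡ-≤ d 2≤n) (≤-reflexive (*-comm n d)))) ⟩
    q ^ (d * n * s)     ∎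

-- Enumerations without repetition.

record ListsOnce {A : Set} (_≟ᴬ_ : DecidableEquality A) (xs : List A) : Set where
  constructor lists-once
  field once : ∀ u → ∑ xs (λ x → 𝟙 ⌊ u ≟ᴬ x ⌋) ≡ 1
open ListsOnce

module _ {A : Set} {_≟ᴬ_ : DecidableEquality A} {xs : List A} (O : ListsOnce _≟ᴬ_ xs) where

  -- Because `ListsOnce` is phrased as a count, the indicator of u acts as a Kronecker delta under
  -- the sum.
  ∑-sift : ∀ u (f : A → ℕ) → ∑ xs (λ x → 𝟙 ⌊ u ≟ᴬ x ⌋ * f x) ≡ f u
  ∑-sift u f = begin
    ∑ xs (λ x → 𝟙 ⌊ u ≟ᴬ x ⌋ * f x) ≡⟨ ∑-cong xs diagonal ⟩
    ∑ xs (λ x → 𝟙 ⌊ u ≟ᴬ x ⌋ * f u) ≡⟨ ∑-*ʳ (f u) xs _ ⟩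
    ∑ xs (λ x → 𝟙 ⌊ u ≟ᴬ x ⌋) * f u ≡⟨ cong (_* f u) (once O u) ⟩
    1 * f u                         ≡⟨ *-identityˡ (f u) ⟩
    f u                             ∎
    where
    open ≡-Reasoning
    diagonal : ∀ x → 𝟙 ⌊ u ≟ᴬ x ⌋ * f x ≡ 𝟙 ⌊ u ≟ᴬ x ⌋ * f u
    diagonal x with u ≟ᴬ x
    ... | yes refl = refl
    ... | no  _    = refl

  ∑-others : ∀ u → suc (∑ xs (λ x → 𝟙 (not ⌊ u ≟ᴬ x ⌋))) ≡ length xs
  ∑-others u = begin
    1 + ∑ xs (λ x → 𝟙 (not ⌊ u ≟ᴬ x ⌋))                     ≡⟨ cong (_+ ∑ xs (λ x → 𝟙 (not ⌊ u ≟ᴬ x ⌋))) (once O u) ⟨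
    ∑ xs (λ x → 𝟙 ⌊ u ≟ᴬ x ⌋) + ∑ xs (λ x → 𝟙 (not ⌊ u ≟ᴬ x ⌋)) ≡⟨ 𝟙-complement xs (λ x → ⌊ u ≟ᴬ x ⌋) ⟩
    length xs                                                 ∎
    where open ≡-Reasoning

-- Needed because equality of successors in `Fin` is decided by a `map′` of the decision for their
-- predecessors.
isYes-map′ : {A B : Set} {f : A → B} {g : B → A} (a? : Dec A) → ⌊ map′ f g a? ⌋ ≡ ⌊ a? ⌋
isYes-map′ (yes _) = refl
isYes-map′ (no _)  = refl

allFin-once : ∀ n → ListsOnce Fin._≟_ (allFin n)
allFin-once zero    = lists-once λ ()
allFin-once (suc n) = lists-once λ u → trans (cong (𝟙 ⌊ u Fin.≟ zero ⌋ +_) (tail-as-map u)) (helper u)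
  where
  tail-as-map : ∀ u → ∑ (tabulate {n = n} suc) (λ x → 𝟙 ⌊ u Fin.≟ x ⌋) ≡ ∑ (allFin n) (λ x → 𝟙 ⌊ u Fin.≟ suc x ⌋)
  tail-as-map u = cong (foldr _+_ 0)
    (trans (map-tabulate {n = n} suc (λ x → 𝟙 ⌊ u Fin.≟ x ⌋)) (sym (map-tabulate {n = n} id _)))
  helper : ∀ u → 𝟙 ⌊ u Fin.≟ zero ⌋ + ∑ (allFin n) (λ x → 𝟙 ⌊ u Fin.≟ suc x ⌋) ≡ 1
  helper zero    = cong suc (∑-0 (allFin n))
  helper (suc v) = trans (∑-cong (allFin n) (λ x → cong 𝟙 (isYes-map′ (v Fin.≟ x)))) (once (allFin-once n) v)

_≟ᵛ_ : ∀ {n d} → DecidableEquality (Vec (Fin n) d)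
_≟ᵛ_ = Vec.≡-dec Fin._≟_

∑-vecs : ∀ n d (f : Vec (Fin n) (suc d) → ℕ) →
         ∑ (allVecs n (suc d)) f ≡ ∑ (allFin n) (λ a → ∑ (allVecs n d) (λ x → f (a ∷ x)))
∑-vecs n d f = ∑-grid _∷_ (allFin n) (allVecs n d) f

𝟙-∷ : ∀ {n d} (a b : Fin n) (x y : Vec (Fin n) d) →
      𝟙 ⌊ (a ∷ x) ≟ᵛ (b ∷ y) ⌋ ≡ 𝟙 ⌊ a Fin.≟ b ⌋ * 𝟙 ⌊ x ≟ᵛ y ⌋
𝟙-∷ a b x y with a Fin.≟ b | x ≟ᵛ y
... | yes _ | yes _ = refl
... | yes _ | no  _ = refl
... | no  _ | yes _ = refl
... | no  _ | no  _ = refl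

allVecs-once : ∀ n d → ListsOnce _≟ᵛ_ (allVecs n d)
allVecs-once n zero    = lists-once λ { [] → refl }
allVecs-once n (suc d) = lists-once λ { (a ∷ x) → begin
  ∑ (allVecs n (suc d)) (λ y → 𝟙 ⌊ (a ∷ x) ≟ᵛ y ⌋)
    ≡⟨ ∑-vecs n d _ ⟩
  ∑ (allFin n) (λ b → ∑ (allVecs n d) (λ y → 𝟙 ⌊ (a ∷ x) ≟ᵛ (b ∷ y) ⌋))
    ≡⟨ ∑-cong (allFin n) (λ b → trans (∑-cong (allVecs n d) (𝟙-∷ a b x)) (∑-*ˡ (𝟙 ⌊ a Fin.≟ b ⌋) (allVecs n d) _)) ⟩
  ∑ (allFin n) (λ b → 𝟙 ⌊ a Fin.≟ b ⌋ * ∑ (allVecs n d) (λ y → 𝟙 ⌊ x ≟ᵛ y ⌋))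
    ≡⟨ ∑-sift (allFin-once n) a _ ⟩
  ∑ (allVecs n d) (λ y → 𝟙 ⌊ x ≟ᵛ y ⌋)
    ≡⟨ once (allVecs-once n d) x ⟩
  1 ∎ }
  where open ≡-Reasoning

length-allFin : ∀ n → length (allFin n) ≡ n
length-allFin n = length-tabulate {n = n} id

length-∑ : {A : Set} (xs : List A) → length xs ≡ ∑ xs (λ _ → 1)
length-∑ xs = sym (trans (∑-const 1 xs) (*-identityʳ _))

length-allVecs : ∀ n d → length (allVecs n d) ≡ n ^ d
length-allVecs n zero    = refl
length-allVecs n (suc d) = begin
  length (allVecs n (suc d))                           ≡⟨ length-∑ (allVecs n (suc d)) ⟩
  ∑ (allVecs n (suc d)) (λ _ → 1)                      ≡⟨ ∑-vecs n d _ ⟩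
  ∑ (allFin n) (λ a → ∑ (allVecs n d) (λ _ → 1))       ≡⟨ ∑-const _ (allFin n) ⟩
  length (allFin n) * ∑ (allVecs n d) (λ _ → 1)        ≡⟨ cong₂ _*_ (length-allFin n) (sym (length-∑ (allVecs n d))) ⟩
  n * length (allVecs n d)                             ≡⟨ cong (n *_) (length-allVecs n d) ⟩
  n ^ suc d                                            ∎
  where open ≡-Reasoning

-- Degrees and edge boundaries in the Hamming graph.

hdist-refl : ∀ {n d} (x : Vec (Fin n) d) → hdist x x ≡ 0
hdist-refl []      = refl
hdist-refl (a ∷ x) with a Fin.≟ a
... | yes _  = hdist-refl x
... | no a≢a = contradiction refl a≢a

hdist≡0⇒≡ : ∀ {n d} (x y : Vec (Fin n) d) → hdist x y ≡ 0 → x ≡ y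
hdist≡0⇒≡ []      []      _ = refl
hdist≡0⇒≡ (a ∷ x) (b ∷ y) h with a Fin.≟ b
... | yes refl = cong (a ∷_) (hdist≡0⇒≡ x y h)

-- An edge either keeps the first coordinate and is an edge of the layer, or changes it and keeps
-- all the others.
adj-∷ : ∀ {n d} (a b : Fin n) (x y : Vec (Fin n) d) →
        𝟙 ⌊ hdist (a ∷ x) (b ∷ y) ≟ 1 ⌋ ≤ 𝟙 ⌊ a Fin.≟ b ⌋ * 𝟙 ⌊ hdist x y ≟ 1 ⌋ + 𝟙 (not ⌊ a Fin.≟ b ⌋) * 𝟙 ⌊ x ≟ᵛ y ⌋
adj-∷ a b x y with a Fin.≟ b | x ≟ᵛ y
... | yes _ | _     = ≤-reflexive (sym (trans (+-identityʳ _) (*-identityˡ _)))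
... | no  _ | yes _ = 𝟙≤1 ⌊ suc (hdist x y) ≟ 1 ⌋
... | no  _ | no x≢y with suc (hdist x y) ≟ 1
...   | yes h = contradiction (hdist≡0⇒≡ x y (suc-injective h)) x≢y
...   | no  _ = z≤n

degree-bound : ∀ n d (x : Vec (Fin (suc n)) d) → ∑ (allVecs (suc n) d) (λ y → 𝟙 ⌊ hdist x y ≟ 1 ⌋) ≤ d * n
degree-bound n zero    []      = z≤n
degree-bound n (suc d) (a ∷ x) = begin
  ∑ (allVecs N (suc d)) (λ y → 𝟙 ⌊ hdist (a ∷ x) y ≟ 1 ⌋)
    ≡⟨ ∑-vecs N d _ ⟩
  ∑ as (λ b → ∑ xs (λ y → 𝟙 ⌊ hdist (a ∷ x) (b ∷ y) ≟ 1 ⌋))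
    ≤⟨ ∑-mono as (λ b → ∑-mono xs (adj-∷ a b x)) ⟩
  ∑ as (λ b → ∑ xs (λ y → 𝟙 ⌊ a Fin.≟ b ⌋ * 𝟙 ⌊ hdist x y ≟ 1 ⌋ + 𝟙 (not ⌊ a Fin.≟ b ⌋) * 𝟙 ⌊ x ≟ᵛ y ⌋))
    ≡⟨ ∑-cong as (λ b → trans (∑-+ xs _ _) (cong₂ _+_ (∑-*ˡ (𝟙 ⌊ a Fin.≟ b ⌋) xs _)
         (trans (∑-*ˡ (other b) xs _) (trans (cong (other b *_) (once (allVecs-once N d) x)) (*-identityʳ (other b)))))) ⟩
  ∑ as (λ b → 𝟙 ⌊ a Fin.≟ b ⌋ * deg + 𝟙 (not ⌊ a Fin.≟ b ⌋))
    ≡⟨ ∑-+ as (λ b → 𝟙 ⌊ a Fin.≟ b ⌋ * deg) other ⟩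
  ∑ as (λ b → 𝟙 ⌊ a Fin.≟ b ⌋ * deg) + ∑ as (λ b → 𝟙 (not ⌊ a Fin.≟ b ⌋))
    ≡⟨ cong₂ _+_ (∑-sift (allFin-once N) a (λ _ → deg))
                 (suc-injective (trans (∑-others (allFin-once N) a) (length-allFin N))) ⟩
  deg + n
    ≤⟨ +-monoˡ-≤ n (degree-bound n d x) ⟩
  d * n + n
    ≡⟨ +-comm (d * n) n ⟩
  suc d * n ∎
  where
  open ≤-Reasoning
  N = suc n
  as = allFin N
  xs = allVecs N d
  deg = ∑ xs (λ y → 𝟙 ⌊ hdist x y ≟ 1 ⌋)
  other = λ b → 𝟙 (not ⌊ a Fin.≟ b ⌋)

-- The edges of the layers x₀ = a, and the edges in the first direction.
boundary-split : ∀ n d (S : Vec (Fin n) (suc d) → Bool) →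
  ∑ (allFin n) (λ a → boundary (Hamming n d) (λ x → S (a ∷ x)))
  + ∑ (allVecs n d) (λ x → ∑ (allFin n) (λ a → 𝟙 (S (a ∷ x))) * ∑ (allFin n) (λ b → 𝟙 (not (S (b ∷ x)))))
  ≤ boundary (Hamming n (suc d)) S
boundary-split n d S = begin
  ∑ as (λ a → boundary (Hamming n d) (λ x → S (a ∷ x)))
  + ∑ xs (λ x → ∑ as (λ a → 𝟙 (S (a ∷ x))) * ∑ as (λ b → 𝟙 (not (S (b ∷ x)))))
    -- Kronecker deltas for a = b and for x = y are inserted so that both sums range over all a, x,
    -- b, y and can be compared with the boundary term by term.
    ≡⟨ cong₂ _+_ (∑-cong as (λ a → ∑-cong xs (λ x → sym (∑-sift (allFin-once n) a (λ _ → ∑ xs (λ y → inside a x y)))))) lines ⟩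
  ∑ as (λ a → ∑ xs (λ x → ∑ as (λ b → 𝟙 ⌊ a Fin.≟ b ⌋ * ∑ xs (λ y → inside a x y))))
  + ∑ as (λ a → ∑ xs (λ x → ∑ as (λ b → 𝟙 (S (a ∷ x)) * 𝟙 (not (S (b ∷ x))))))
    ≡⟨ trans (sym (∑-+ as _ _)) (∑-cong as (λ a → trans (sym (∑-+ xs _ _)) (∑-cong xs (λ x → sym (∑-+ as _ _))))) ⟩
  ∑ as (λ a → ∑ xs (λ x → ∑ as (λ b →
    𝟙 ⌊ a Fin.≟ b ⌋ * ∑ xs (λ y → inside a x y) + 𝟙 (S (a ∷ x)) * 𝟙 (not (S (b ∷ x))))))
    ≡⟨ ∑-cong as (λ a → ∑-cong xs (λ x → ∑-cong as (λ b →
         trans (cong₂ _+_ (sym (∑-*ˡ (𝟙 ⌊ a Fin.≟ b ⌋) xs _))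
                     (sym (∑-sift (allVecs-once n d) x (λ y → 𝟙 (S (a ∷ x)) * 𝟙 (not (S (b ∷ y))))))) (sym (∑-+ xs _ _))))) ⟩
  ∑ as (λ a → ∑ xs (λ x → ∑ as (λ b → ∑ xs (λ y →
    𝟙 ⌊ a Fin.≟ b ⌋ * inside a x y + 𝟙 ⌊ x ≟ᵛ y ⌋ * (𝟙 (S (a ∷ x)) * 𝟙 (not (S (b ∷ y))))))))
    ≤⟨ ∑-mono as (λ a → ∑-mono xs (λ x → ∑-mono as (λ b → ∑-mono xs (λ y → edge a b x y)))) ⟩
  ∑ as (λ a → ∑ xs (λ x → ∑ as (λ b → ∑ xs (λ y → crossing (a ∷ x) (b ∷ y)))))
    ≡⟨ trans (∑-vecs n d _) (∑-cong as (λ a → ∑-cong xs (λ x → ∑-vecs n d _))) ⟨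
  boundary (Hamming n (suc d)) S ∎
  where
  open ≤-Reasoning
  as = allFin n
  xs = allVecs n d
  inside : Fin n → Vec (Fin n) d → Vec (Fin n) d → ℕ
  inside a x y = 𝟙 (S (a ∷ x) ∧ not (S (a ∷ y)) ∧ ⌊ hdist x y ≟ 1 ⌋)
  crossing : Vec (Fin n) (suc d) → Vec (Fin n) (suc d) → ℕ
  crossing p q = 𝟙 (S p ∧ not (S q) ∧ ⌊ hdist p q ≟ 1 ⌋)
  lines : ∑ xs (λ x → ∑ as (λ a → 𝟙 (S (a ∷ x))) * ∑ as (λ b → 𝟙 (not (S (b ∷ x)))))
        ≡ ∑ as (λ a → ∑ xs (λ x → ∑ as (λ b → 𝟙 (S (a ∷ x)) * 𝟙 (not (S (b ∷ x))))))
  lines = trans (∑-cong xs (λ x → trans (sym (∑-*ʳ _ as _)) (∑-cong as (λ a → sym (∑-*ˡ (𝟙 (S (a ∷ x))) as _))))) (∑-swap xs as _)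
  edge : ∀ a b x y → 𝟙 ⌊ a Fin.≟ b ⌋ * inside a x y + 𝟙 ⌊ x ≟ᵛ y ⌋ * (𝟙 (S (a ∷ x)) * 𝟙 (not (S (b ∷ y))))
                   ≤ crossing (a ∷ x) (b ∷ y)
  edge a b x y with a Fin.≟ b | x ≟ᵛ y
  -- Both deltas are 1 only when the two vertices coincide, and then every term vanishes.
  ... | yes refl | yes refl = ≤-reflexive (none (S (a ∷ x)))
    where
    none : ∀ s → 1 * 𝟙 (s ∧ not s ∧ ⌊ hdist x x ≟ 1 ⌋) + 1 * (𝟙 s * 𝟙 (not s)) ≡ 𝟙 (s ∧ not s ∧ ⌊ hdist x x ≟ 1 ⌋)
    none true  = refl
    none false = refl
  ... | yes refl | no _     = ≤-reflexive (trans (+-identityʳ _) (*-identityˡ _))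
  ... | no _     | yes refl rewrite hdist-refl x = ≤-reflexive (product-form (S (a ∷ x)) (S (b ∷ x)))
    where
    product-form : ∀ s t → 1 * (𝟙 s * 𝟙 (not t)) ≡ 𝟙 (s ∧ not t ∧ true)
    product-form true  true  = refl
    product-form true  false = refl
    product-form false t     = refl
  ... | no _     | no _     = z≤n

-- |∂S| ≥ (N − 1) |S| log_N (N^d / |S|) for N = suc n.
edge-isoperimetry : ∀ n d (S : Vec (Fin (suc n)) d → Bool) → let s = ∑ (allVecs (suc n) d) (λ x → 𝟙 (S x)) in
  suc n ^ (d * (n * s)) ≤ suc n ^ boundary (Hamming (suc n) d) S * (s ^ s) ^ n
-- The left side is N ^ 0 = 1, and both factors on the right are positive, again because 0 ^ 0 = 1.
edge-isoperimetry n zero    S = *-mono-≤ (m^n>0 (suc n) (boundary (Hamming (suc n) 0) S))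
  (m^n>0 _ {{>-nonZero (n^n>0 (∑ (allVecs (suc n) 0) (λ x → 𝟙 (S x))))}} n)
edge-isoperimetry n (suc d) S = begin
  -- The share n s of the exponent is paid for by the lines in the first direction, and d n s by the
  -- induction hypothesis on the layers.
  N ^ (n * s + d * (n * s))
    ≡⟨ ^-distribˡ-+-* N (n * s) _ ⟩
  N ^ (n * s) * N ^ (d * (n * s))
    ≤⟨ *-mono-≤ columns layers ⟩
  N ^ ∑ xs (λ x → m x * c x) * ∏ xs (λ x → m x ^ m x) ^ n * (N ^ ∑ as b * ∏ as (λ a → r a ^ r a) ^ n)
    ≡⟨ *-interchange (N ^ ∑ xs (λ x → m x * c x)) _ _ _ ⟩
  N ^ ∑ xs (λ x → m x * c x) * N ^ ∑ as b * (∏ xs (λ x → m x ^ m x) ^ n * ∏ as (λ a → r a ^ r a) ^ n)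
    ≡⟨ cong₂ _*_ (trans (sym (^-distribˡ-+-* N (∑ xs (λ x → m x * c x)) (∑ as b))) (cong (N ^_) (+-comm _ (∑ as b))))
                 (trans (sym (^-distribʳ-* n _ _)) (cong (_^ n) (*-comm (∏ xs (λ x → m x ^ m x)) _))) ⟩
  N ^ (∑ as b + ∑ xs (λ x → m x * c x)) * (∏ as (λ a → r a ^ r a) * ∏ xs (λ x → m x ^ m x)) ^ n
    ≤⟨ *-mono-≤ (^-monoʳ-≤ N (boundary-split N d S)) (^-monoˡ-≤ n margins) ⟩
  N ^ boundary (Hamming N (suc d)) S * (s ^ s) ^ n ∎
  where
  open ≤-Reasoning
  N = suc n
  as = allFin N
  xs = allVecs N d
  s = ∑ (allVecs N (suc d)) (λ x → 𝟙 (S x))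
  b = λ a → boundary (Hamming N d) (λ x → S (a ∷ x))
  r = λ a → ∑ xs (λ x → 𝟙 (S (a ∷ x)))
  m = λ x → ∑ as (λ a → 𝟙 (S (a ∷ x)))
  c = λ x → ∑ as (λ a → 𝟙 (not (S (a ∷ x))))
  s≡∑r : s ≡ ∑ as r
  s≡∑r = ∑-vecs N d _
  s≡∑m : s ≡ ∑ xs m
  s≡∑m = trans s≡∑r (∑-swap as xs _)
  margins : ∏ as (λ a → r a ^ r a) * ∏ xs (λ x → m x ^ m x) ≤ s ^ s
  margins = subst (λ t → ∏ as (λ a → r a ^ r a) * ∏ xs (λ x → m x ^ m x) ≤ t ^ t) (sym s≡∑r) (margins-bound as xs (λ a x → S (a ∷ x)))
  m+c : ∀ x → m x + c x ≡ N
  m+c x = trans (𝟙-complement as (λ a → S (a ∷ x))) (length-allFin N)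
  columns : N ^ (n * s) ≤ N ^ ∑ xs (λ x → m x * c x) * ∏ xs (λ x → m x ^ m x) ^ n
  columns = begin
    N ^ (n * s)                                    ≡⟨ cong (N ^_) (trans (cong (n *_) s≡∑m) (sym (∑-*ˡ n xs m))) ⟩
    N ^ ∑ xs (λ x → n * m x)                       ≡⟨ ^-∑ N xs _ ⟩
    ∏ xs (λ x → N ^ (n * m x))                     ≤⟨ ∏-mono xs (λ x → column-bound n (m x) (c x) (m+c x)) ⟩
    ∏ xs (λ x → N ^ (m x * c x) * (m x ^ m x) ^ n) ≡⟨ ∏-* xs _ _ ⟩
    _                                              ≡⟨ cong₂ _*_ (sym (^-∑ N xs _)) (∏-^ n xs _) ⟩
    N ^ ∑ xs (λ x → m x * c x) * ∏ xs (λ x → m x ^ m x) ^ n ∎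
  layers : N ^ (d * (n * s)) ≤ N ^ ∑ as b * ∏ as (λ a → r a ^ r a) ^ n
  layers = begin
    N ^ (d * (n * s))                     ≡⟨ cong (N ^_) (trans (cong (λ t → d * (n * t)) s≡∑r)
                                               (trans (cong (d *_) (sym (∑-*ˡ n as r))) (sym (∑-*ˡ d as _)))) ⟩
    N ^ ∑ as (λ a → d * (n * r a))        ≡⟨ ^-∑ N as (λ a → d * (n * r a)) ⟩
    ∏ as (λ a → N ^ (d * (n * r a)))      ≤⟨ ∏-mono as (λ a → edge-isoperimetry n d (λ x → S (a ∷ x))) ⟩
    ∏ as (λ a → N ^ b a * (r a ^ r a) ^ n) ≡⟨ ∏-* as (λ a → N ^ b a) (λ a → (r a ^ r a) ^ n) ⟩
    ∏ as (λ a → N ^ b a) * ∏ as (λ a → (r a ^ r a) ^ n) ≡⟨ cong₂ _*_ (sym (^-∑ N as b)) (∏-^ n as (λ a → r a ^ r a)) ⟩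
    N ^ ∑ as b * ∏ as (λ a → r a ^ r a) ^ n ∎

-- Reachability, and double negation over finite types.

Reach-map : {V : Set} {E F : V → V → Set} → (∀ {x y} → E x y → F x y) → ∀ {x y} → Reach E x y → Reach F x y
Reach-map f here       = here
Reach-map f (step e r) = step (f e) (Reach-map f r)

Reach-trans : {V : Set} {E : V → V → Set} {x y z : V} → Reach E x y → Reach E y z → Reach E x z
Reach-trans here       s = s
Reach-trans (step e r) s = step e (Reach-trans r s)

Reach-sym : {V : Set} {E : V → V → Set} → (∀ {x y} → E x y → E y x) → ∀ {x y} → Reach E x y → Reach E y x
Reach-sym E-sym here       = here
Reach-sym E-sym (step e r) = Reach-trans (Reach-sym E-sym r) (step (E-sym e) here)

Minus-flip : {V : Set} (E : V → V → Set) {u v x y : V} → Minus E u v x y → Minus E v u x y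
Minus-flip E (e , ne) = e , λ { (inj₁ p) → ne (inj₂ p) ; (inj₂ p) → ne (inj₁ p) }

Minus-sym : {V : Set} (E : V → V → Set) → (∀ x y → E x y → E y x) → ∀ {u v x y} → Minus E u v x y → Minus E u v y x
Minus-sym E E-sym (e , ne) = E-sym _ _ e , λ { (inj₁ (p , q)) → ne (inj₂ (q , p)) ; (inj₂ (p , q)) → ne (inj₁ (q , p)) }

module _ {A : Set} {_≟ᴬ_ : DecidableEquality A} {xs : List A} (O : ListsOnce _≟ᴬ_ xs) where

  ∈-listed : ∀ u → u ∈ xs
  ∈-listed u = search xs (λ none → contradiction (trans (sym (ListsOnce.once O u)) none) λ ())
    where
    search : ∀ ys → ∑ ys (λ x → 𝟙 ⌊ u ≟ᴬ x ⌋) ≢ 0 → u ∈ ys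
    search []       h = contradiction refl h
    search (y ∷ ys) h with u ≟ᴬ y
    ... | yes u≡y = here u≡y
    ... | no  _   = there (search ys h)

  -- Double negation passes through a quantifier over a finite type. An arbitrary tree relation can
  -- thus be treated as decidable, and its components counted, while a stable goal is proved.
  ¬¬-∀ : {P : A → Set} → (∀ x → ¬ ¬ P x) → ¬ ¬ (∀ x → P x)
  ¬¬-∀ {P} h ¬∀ = all xs (λ ps → ¬∀ (λ x → All.lookup ps (∈-listed x)))
    where
    all : ∀ ys → ¬ ¬ All P ys
    all []       k = k []
    all (y ∷ ys) k = h y (λ p → all ys (λ ps → k (p ∷ ps)))

-- Branches of a spanning tree and a balanced edge.

module Tree {V : Set} {_≟ⱽ_ : DecidableEquality V} {verts : List V} (O : ListsOnce _≟ⱽ_ verts)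
            (T : V → V → Set)
            (T-sym : ∀ x y → T x y → T y x)
            (conn : ∀ x y → Reach T x y)
            (acyclic : ∀ x y → T x y → ¬ Reach (Minus T x y) x y)
            (T? : ∀ x y → Dec (T x y))
            (side? : ∀ u v x → Dec (Reach (Minus T u v) u x))
  where

  side : V → V → V → Bool
  side u v x = ⌊ side? u v x ⌋

  size : V → V → ℕ
  size u v = ∑ verts (λ x → 𝟙 (side u v x))

  -- A common vertex would give a walk from u to v that avoids the edge joining them.
  sides-disjoint : ∀ {u v x} → T u v → Reach (Minus T u v) u x → ¬ Reach (Minus T v u) v x
  sides-disjoint Tuv r s =
    acyclic _ _ Tuv (Reach-trans r (Reach-sym (Minus-sym T T-sym) (Reach-map (Minus-flip T) s)))

  size-complement : ∀ u v → T u v → size u v + size v u ≤ length verts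
  size-complement u v Tuv = begin
    size u v + size v u                                  ≡⟨ ∑-+ verts _ _ ⟨
    ∑ verts (λ x → 𝟙 (side u v x) + 𝟙 (side v u x))      ≤⟨ ∑-mono verts pointwise ⟩
    ∑ verts (λ _ → 1)                                    ≡⟨ length-∑ verts ⟨
    length verts                                         ∎
    where
    open ≤-Reasoning
    pointwise : ∀ x → 𝟙 (side u v x) + 𝟙 (side v u x) ≤ 1
    pointwise x with side? u v x | side? v u x
    ... | yes r | yes s = contradiction s (sides-disjoint Tuv r)
    ... | yes _ | no  _ = ≤-refl
    ... | no  _ | yes _ = ≤-refl
    ... | no  _ | no  _ = z≤n

  -- A walk in the branch at x never meets w, as it would reach w without the edge between x and w.
  -- Hence it never uses the edge between w and u, and neither does the step from w to x, as x ≠ u.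
  branch-⊂ : ∀ {x w u y} → T x w → x ≢ u → Reach (Minus T x w) x y → Reach (Minus T w u) w y
  branch-⊂ {x} {w} {u} Txw x≢u r = step (T-sym _ _ Txw , not-wu) (avoid here r)
    where
    not-wu : ¬ ((w ≡ w × x ≡ u) ⊎ (w ≡ u × x ≡ w))
    not-wu (inj₁ (_ , x≡u))   = x≢u x≡u
    not-wu (inj₂ (w≡u , x≡w)) = x≢u (trans x≡w w≡u)
    -- The first argument keeps the walk made so far, which contradicts acyclicity as soon as it
    -- arrives at w.
    avoid : ∀ {p y} → Reach (Minus T x w) x p → Reach (Minus T x w) p y → Reach (Minus T w u) p y
    avoid before here = here
    avoid before (step {y = q} e after) = step (proj₁ e , not-wu′) (avoid up-to-q after)
      where
      up-to-q = Reach-trans before (step e here)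
      not-wu′ : ¬ ((_ ≡ w × q ≡ u) ⊎ (_ ≡ u × q ≡ w))
      not-wu′ (inj₁ (refl , _)) = acyclic _ _ Txw before
      not-wu′ (inj₂ (_ , refl)) = acyclic _ _ Txw up-to-q

  -- Strict because w lies in its own branch but, by acyclicity, not in the one at x; the delta at w
  -- counts this extra vertex.
  branch-smaller : ∀ {x w u} → T x w → x ≢ u → size x w < size w u
  branch-smaller {x} {w} {u} Txw x≢u = begin
    suc (size x w)                                    ≡⟨ cong (_+ size x w) (ListsOnce.once O w) ⟨
    ∑ verts (λ y → 𝟙 ⌊ w ≟ⱽ y ⌋) + size x w           ≡⟨ ∑-+ verts _ _ ⟨
    ∑ verts (λ y → 𝟙 ⌊ w ≟ⱽ y ⌋ + 𝟙 (side x w y))     ≤⟨ ∑-mono verts pointwise ⟩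
    size w u                                          ∎
    where
    open ≤-Reasoning
    pointwise : ∀ y → 𝟙 ⌊ w ≟ⱽ y ⌋ + 𝟙 (side x w y) ≤ 𝟙 (side w u y)
    pointwise y with w ≟ⱽ y | side? x w y | side? w u y
    ... | yes refl | yes r | _     = contradiction r (acyclic _ _ Txw)
    ... | yes refl | no  _ | yes _ = ≤-refl
    ... | yes refl | no  _ | no ¬r = contradiction here ¬r
    ... | no  _    | yes _ | yes _ = ≤-refl
    ... | no  _    | yes r | no ¬r = contradiction (branch-⊂ Txw x≢u r) ¬r
    ... | no  _    | no  _ | _     = z≤n

  -- The first edge after the last visit of u.
  last-exit : ∀ u {x y} → Reach T x y → y ≢ u →
              (Σ V λ w → T u w × Reach (Minus T w u) w y)
              ⊎ (x ≢ u × Reach (λ p q → T p q × p ≢ u × q ≢ u) x y)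
  last-exit u here y≢u = inj₂ (y≢u , here)
  last-exit u (step {x} {z} Txz r) y≢u with last-exit u r y≢u
  ... | inj₁ found = inj₁ found
  ... | inj₂ (z≢u , s) with x ≟ⱽ u
  ...   | yes refl = inj₁ (z , Txz , Reach-map avoids s)
    where
    avoids : ∀ {p q} → T p q × p ≢ u × q ≢ u → Minus T z u p q
    avoids (e , p≢u , q≢u) = e , λ { (inj₁ (_ , q≡u)) → q≢u q≡u ; (inj₂ (p≡u , _)) → p≢u p≡u }
  ...   | no x≢u = inj₂ (x≢u , step (Txz , x≢u , z≢u) s)

  -- On a walk from u to y, the neighbour entered after the last visit of u has y in its branch.
  branches-cover : ∀ u y → 𝟙 (not ⌊ u ≟ⱽ y ⌋) ≤ ∑ verts (λ w → 𝟙 ⌊ T? u w ⌋ * 𝟙 (side w u y))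
  branches-cover u y with u ≟ⱽ y
  ... | yes _  = z≤n
  ... | no u≢y with last-exit u (conn u y) (u≢y ∘ sym)
  ...   | inj₂ (u≢u , _)     = contradiction refl u≢u
  ...   | inj₁ (w , Tuw , r) = begin
    1                                              ≡⟨ ListsOnce.once O w ⟨
    ∑ verts (λ x → 𝟙 ⌊ w ≟ⱽ x ⌋)                   ≤⟨ ∑-mono verts pointwise ⟩
    ∑ verts (λ x → 𝟙 ⌊ T? u x ⌋ * 𝟙 (side x u y))  ∎
    where
    open ≤-Reasoning
    pointwise : ∀ x → 𝟙 ⌊ w ≟ⱽ x ⌋ ≤ 𝟙 ⌊ T? u x ⌋ * 𝟙 (side x u y)
    pointwise x with w ≟ⱽ x
    ... | no  _    = z≤n
    ... | yes refl with T? u w | side? w u y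
    ...   | yes _   | yes _ = ≤-refl
    ...   | no ¬Tuw | _     = contradiction Tuw ¬Tuw
    ...   | yes _   | no ¬r = contradiction r ¬r

  module _ (Δ : ℕ) {{_ : NonZero Δ}} (degree : ∀ u → ∑ verts (λ w → 𝟙 ⌊ T? u w ⌋) ≤ Δ)
           (2≤|V| : 2 ≤ length verts) where

    -- Averaging: with |V| = m + 2, small branches satisfy Δ · size ≤ m. At most Δ of them cover the
    -- m + 1 vertices other than u, so Δ (m + 1) ≤ Δ m.
    has-large-branch : ∀ u → ¬ (∀ w → T u w → suc (Δ * size w u) < length verts)
    has-large-branch u small with m≤n⇒∃[o]m+o≡n 2≤|V|
    ... | m , 2+m≡|V| = 1+n≰n (*-cancelˡ-≤ Δ (begin
      Δ * suc m
        ≡⟨ cong (Δ *_) (suc-injective (trans 2+m≡|V| (sym (∑-others O u)))) ⟩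
      Δ * ∑ verts (λ y → 𝟙 (not ⌊ u ≟ⱽ y ⌋))
        ≤⟨ *-monoʳ-≤ Δ (∑-mono verts (branches-cover u)) ⟩
      Δ * ∑ verts (λ y → ∑ verts (λ w → 𝟙 ⌊ T? u w ⌋ * 𝟙 (side w u y)))
        ≡⟨ cong (Δ *_) (trans (∑-swap verts verts _) (∑-cong verts (λ w → ∑-*ˡ (𝟙 ⌊ T? u w ⌋) verts _))) ⟩
      Δ * ∑ verts (λ w → 𝟙 ⌊ T? u w ⌋ * size w u)
        ≡⟨ ∑-*ˡ Δ verts _ ⟨
      ∑ verts (λ w → Δ * (𝟙 ⌊ T? u w ⌋ * size w u))
        ≤⟨ ∑-mono verts pointwise ⟩
      ∑ verts (λ w → 𝟙 ⌊ T? u w ⌋ * m)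
        ≡⟨ ∑-*ʳ m verts _ ⟩
      ∑ verts (λ w → 𝟙 ⌊ T? u w ⌋) * m
        ≤⟨ *-monoˡ-≤ m (degree u) ⟩
      Δ * m ∎))
      where
      open ≤-Reasoning
      pointwise : ∀ w → Δ * (𝟙 ⌊ T? u w ⌋ * size w u) ≤ 𝟙 ⌊ T? u w ⌋ * m
      pointwise w with T? u w
      ... | no  _   = ≤-reflexive (*-zeroʳ Δ)
      ... | yes Tuw = begin
        Δ * (1 * size w u) ≡⟨ cong (Δ *_) (*-identityˡ (size w u)) ⟩
        Δ * size w u       ≤⟨ s≤s⁻¹ (s≤s⁻¹ (subst (2 + Δ * size w u ≤_) (sym 2+m≡|V|) (small w Tuw))) ⟩
        m                  ≡⟨ *-identityˡ m ⟨
        1 * m              ∎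

    -- Descend along large branches: while the branch at w, cut off at u, holds more than half of the
    -- vertices, another neighbour of w carries a large and strictly smaller branch.
    balanced-edge : V → ¬ (∀ u v → T u v → length verts ≤ suc (Δ * size u v) → ¬ (2 * size u v ≤ length verts))
    balanced-edge root none = has-large-branch root (λ w Trw → ≰⇒> (descend _ (T-sym _ _ Trw) ≤-refl))
      where
      -- The bound is the termination measure, since branch sizes strictly decrease along the
      -- descent.
      descend : ∀ bound {w u} → T w u → size w u ≤ bound → ¬ (length verts ≤ suc (Δ * size w u))
      descend bound {w} {u} Twu ≤bound large with 2 * size w u ≤? length verts
      ... | yes light = none w u Twu large light
      descend zero {w} {u} Twu ≤bound large | no heavy =
        heavy (≤-trans (*-monoʳ-≤ 2 ≤bound) z≤n)
      descend (suc bound) {w} {u} Twu ≤bound large | no heavy = has-large-branch w small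
        where
        open ≤-Reasoning
        u-light : 2 * size u w ≤ length verts
        u-light = ≮⇒≥ λ u-heavy → <-irrefl refl (begin-strict
          length verts + length verts     <⟨ +-mono-< (≰⇒> heavy) u-heavy ⟩
          2 * size w u + 2 * size u w     ≡⟨ *-distribˡ-+ 2 (size w u) _ ⟨
          2 * (size w u + size u w)       ≤⟨ *-monoʳ-≤ 2 (size-complement w u Twu) ⟩
          2 * length verts                ≡⟨ cong (length verts +_) (+-identityʳ _) ⟩
          length verts + length verts     ∎)
        small : ∀ x → T w x → suc (Δ * size x w) < length verts
        small x Twx with x ≟ⱽ u
        -- The descent never turns back: the branch at u is light, so if it were large, this edge
        -- would already be balanced.
        ... | yes refl = ≰⇒> λ u-large → none u w (T-sym _ _ Twu) u-large u-light
        ... | no x≢u   = ≰⇒> (descend bound (T-sym _ _ Twx)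
                           (s≤s⁻¹ (≤-trans (branch-smaller (T-sym _ _ Twx) x≢u) ≤bound)))

-- Congestion of an optimal spanning tree of the Hamming graph.

theorem1 : ∀ (n d : ℕ) → 3 ≤ n → 3 ≤ d → ∀ (k : ℕ) → IsSTC (Hamming n d) k
    → d ^ (n ^ d ∸ 1) ≤ n ^ (d * k)
theorem1 (suc n) d (s≤s 2≤n) 3≤d k ((T , tree , _ , maximal) , _) =
  -- The goal compares two numbers and is therefore stable, so adjacency in T and membership in its
  -- components may be decided under a double negation.
  decidable-stable (_ ≤? _) λ ¬goal →
  ¬¬-∀ O (λ x → ¬¬-∀ O (λ y → ¬¬-excluded-middle)) λ T? →
  ¬¬-∀ O (λ u → ¬¬-∀ O (λ v → ¬¬-∀ O (λ x → ¬¬-excluded-middle))) λ side? →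
  let open Tree O T (SpanningTree.sym tree) conn acyclic T? side? in
  balanced-edge (d * n) {{Δ≢0}} (degree T?) 2≤|V| (replicate d zero)
    λ u v Tuv large light → ¬goal (≤-trans
      (congestion-arithmetic n d (size u v) (boundary G (side u v)) 2≤n 3≤d
        (subst (_≤ suc (d * n * size u v)) |V| large) (subst (2 * size u v ≤_) |V| light)
        (edge-isoperimetry n d (side u v)))
      -- The balanced edge has congestion at most k, with its decided side as the witness for the
      -- component.
      (^-monoʳ-≤ (suc n) (*-monoʳ-≤ d (maximal u v _ Tuv (side u v , (λ x → side-spec (side? u v x)) , refl)))))
  where
  open SpanningTree tree using (sub; conn; acyclic)
  G = Hamming (suc n) d
  O = allVecs-once (suc n) d
  |V| : length (allVecs (suc n) d) ≡ suc n ^ d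
  |V| = length-allVecs (suc n) d
  Δ≢0 : NonZero (d * n)
  Δ≢0 = m*n≢0 d n {{>-nonZero (≤-trans (s≤s z≤n) 3≤d)}} {{>-nonZero (≤-trans (s≤s z≤n) 2≤n)}}
  2≤|V| : 2 ≤ length (allVecs (suc n) d)
  2≤|V| = subst (2 ≤_) (sym |V|) (2≤[1+n]^d n d 2≤n 3≤d)
  side-spec : ∀ {P : Set} (p? : Dec P) → (⌊ p? ⌋ ≡ true) ⇔ P
  side-spec (yes p) = mk⇔ (λ _ → p) (λ _ → refl)
  side-spec (no ¬p) = mk⇔ (λ ()) (λ p → contradiction p ¬p)
  degree : (T? : ∀ x y → Dec (T x y)) → ∀ u → ∑ (allVecs (suc n) d) (λ w → 𝟙 ⌊ T? u w ⌋) ≤ d * n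
  degree T? u = ≤-trans (∑-mono (allVecs (suc n) d) pointwise) (degree-bound n d u)
    where
    pointwise : ∀ w → 𝟙 ⌊ T? u w ⌋ ≤ 𝟙 ⌊ hdist u w ≟ 1 ⌋
    pointwise w with T? u w
    ... | no  _   = z≤n
    ... | yes Tuw = ≤-reflexive (cong 𝟙 (sym (sub u w Tuw)))
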